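{- Let $\Gamma=(V,E)$ be a finite, undirected, weighted, connected graph with $N\ge 2$ vertices (loops allowed), let $l\ge 1$ be an integer, and let $\Gamma[l]$ be its neighborhood graph of order $l$. Then for every function $u:V\to\mathbb{R}$, $$(I-(I-\Delta)^{l})u=(I-P^{l})u=\Delta[l]u,$$ where $\Delta$ is the normalized graph Laplace operator of $\Gamma$, $P=I-\Delta$ is the transition probability operator of the random walk on $\Gamma$, and $\Delta[l]$ is the normalized graph Laplace operator of $\Gamma[l]$.
   Context: The weight function $w:V\times V\to\mathbb{R}$ satisfies $w_{ij}=w_{ji}$, $w_{ij}>0$ if $i\sim j$ (i.e. $i,j$ are joined by an edge; $i=j$ allowed, a loop) and $w_{ij}=0$ otherwise. The degree is $d_i=\sum_{j}w_{ij}$. The normalized Laplace operator acts by $\Delta v(i)=\frac{1}{d_i}\sum_j w_{ij}(v(i)-v(j))$, and $Pv(i)=\frac1{d_i}\sum_j w_{ij}v(j)$. The neighborhood graph $\Gamma[l]$ is the weighted graph on the same vertex set $V$ with weights $w_{ij}[1]=w_{ij}$ and, for $l>1$, $$w_{ij}[l]=\sum_{k_1,\dots,k_{l-1}\in V}\frac{1}{d_{k_1}}\cdots\frac{1}{d_{k_{l-1}}}w_{ik_1}w_{k_1k_2}\cdots w_{k_{l-1}j}.$$ Its degrees are $d_i[l]=\sum_j w_{ij}[l]$, and $\Delta[l]v(i)=\frac{1}{d_i[l]}\sum_j w_{ij}[l](v(i)-v(j))$. -}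

module Defs where

open import Algebra.Apartness.Bundles using (HeytingField)
open import Algebra.Bundles using (CommutativeRing)
import Algebra.Definitions.RawMonoid as RawMonoidDefinitions
import Algebra.Apartness.Properties.HeytingCommutativeRing as HeytingProperties
import Algebra.Properties.CommutativeMonoid.Sum as CommutativeMonoidSum
import Algebra.Properties.CommutativeSemigroup as CommutativeSemigroupProperties
import Algebra.Properties.Semiring.Sum as SemiringSum
open import Data.Fin.Base using (Fin; zero; suc)
open import Data.Nat.Base as ℕ using (ℕ; NonZero; z≤n; s≤s)
open import Data.Product.Base using (∃-syntax; _×_; _,_; proj₁; proj₂)
open import Data.Sum.Base using (_⊎_; inj₁; inj₂; map)
open import Data.Vec.Base as Vec using (Vec; []; _∷_)
open import Data.Vec.Functional using (Vector)
import Data.Vec.Functional.Relation.Binary.Equality.Setoid as VectorEquality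
open import Function.Base using (id; _∘_)
import Function.Endo.Propositional as Endo
open import Level using (_⊔_) renaming (suc to lsuc)
open import Relation.Binary.Construct.Closure.ReflexiveTransitive using (Star; ε; _◅_)
open import Relation.Binary.Core using (Rel)
open import Relation.Binary.Definitions using (Symmetric)
open import Relation.Binary.PropositionalEquality.Core using (_≡_; _≢_)
import Relation.Binary.PropositionalEquality.Core as ≡
open import Relation.Binary.Structures using (IsStrictPartialOrder)
import Relation.Binary.Reasoning.Setoid as ≈-Reasoning
open import Relation.Nullary.Negation.Core using (¬_; contradiction)

-- The real numbers, characterised as a Cauchy-complete Archimedean ordered
-- field.  The axioms are the constructive ones (apartness instead of ≉, no
-- trichotomy), so both the Cauchy reals and, classically, ℝ are models.
-- Weak linearity of _<_ and 0# < 1# follow from the axioms.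
record Reals c ℓ₁ ℓ₂ ℓ₃ : Set (lsuc (c ⊔ ℓ₁ ⊔ ℓ₂ ⊔ ℓ₃)) where
  infix 4 _<_
  field
    heytingField : HeytingField c ℓ₁ ℓ₂

  open HeytingField heytingField public

  field
    _<_                    : Rel Carrier ℓ₃
    <-isStrictPartialOrder : IsStrictPartialOrder _≈_ _<_
    #⇒<⊎>                  : ∀ {x y} → x # y → x < y ⊎ y < x
    <⇒#                    : ∀ {x y} → x < y → x # y
    +-monoˡ-<              : ∀ {x y} z → x < y → x + z < y + z
    *-pos                  : ∀ {x y} → 0# < x → 0# < y → 0# < x * y

  ring : CommutativeRing c ℓ₁
  ring = record { isCommutativeRing = isCommutativeRing }

  private
    module ℕ× = RawMonoidDefinitions (CommutativeRing.+-rawMonoid ring)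

  fromℕ : ℕ → Carrier
  fromℕ n = n ℕ×.× 1#

  IsCauchy : (ℕ → Carrier) → Set (c ⊔ ℓ₃)
  IsCauchy s = ∀ ε → 0# < ε →
    ∃[ N ] (∀ m n → N ℕ.≤ m → N ℕ.≤ n → s m - s n < ε)

  _ConvergesTo_ : (ℕ → Carrier) → Carrier → Set (c ⊔ ℓ₃)
  s ConvergesTo x = ∀ ε → 0# < ε →
    ∃[ N ] (∀ n → N ℕ.≤ n → s n - x < ε × x - s n < ε)

  field
    archimedean : ∀ x → ∃[ n ] x < fromℕ n
    complete    : ∀ s → IsCauchy s → ∃[ x ] s ConvergesTo x

module RealProperties {c ℓ₁ ℓ₂ ℓ₃} (ℝ : Reals c ℓ₁ ℓ₂ ℓ₃) where
  open Reals ℝ hiding (zero)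
  open IsStrictPartialOrder <-isStrictPartialOrder public
    using () renaming (irrefl to <-irrefl; trans to <-trans; <-respˡ-≈ to <-respˡ; <-respʳ-≈ to <-respʳ)
  open HeytingProperties heytingCommutativeRing using (x-0≈x)
  open CommutativeMonoidSum (CommutativeRing.+-commutativeMonoid ring) public using (sum)

  -- The library inverts differences x - y with x # y, hence the detour
  -- through x - 0#.
  recip : ∀ x → x # 0# → Carrier
  recip x x#0 = proj₁ (#⇒invertible x#0)

  recip-inverseˡ : ∀ x (x#0 : x # 0#) → recip x x#0 * x ≈ 1#
  recip-inverseˡ x x#0 =
    trans (*-congˡ (sym (x-0≈x x))) (proj₁ (proj₂ (#⇒invertible x#0)))

  <-weaklyLinear : ∀ {x y} → x < y → ∀ z → x < z ⊎ z < y
  <-weaklyLinear {x} {y} x<y z with #-cotrans (<⇒# x<y) z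
  ... | inj₁ x#z = map id (λ z<x → <-trans z<x x<y) (#⇒<⊎> x#z)
  ... | inj₂ z#y with #⇒<⊎> z#y
  ...   | inj₁ z<y = inj₂ z<y
  ...   | inj₂ y<z = inj₁ (<-trans x<y y<z)

  +-cancelʳ-< : ∀ {x y} z → x + z < y + z → x < y
  +-cancelʳ-< {x} {y} z p =
    <-respˡ (undo x) (<-respʳ (undo y) (+-monoˡ-< (- z) p))
    where
    undo : ∀ t → (t + z) + (- z) ≈ t
    undo t = trans (+-assoc t z (- z)) (trans (+-congˡ (-‿inverseʳ z)) (+-identityʳ t))

  x+y<y⇒x<0 : ∀ {x y} → x + y < y → x < 0#
  x+y<y⇒x<0 {x} {y} p = +-cancelʳ-< y (<-respʳ (sym (+-identityˡ y)) p)

  pos+nonneg : ∀ {x y} → 0# < x → ¬ (y < 0#) → 0# < y + x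
  pos+nonneg {x} {y} 0<x y≮0 with <-weaklyLinear 0<x (y + x)
  ... | inj₁ 0<y+x = 0<y+x
  ... | inj₂ y+x<x = contradiction (x+y<y⇒x<0 y+x<x) y≮0

  sum-nonneg : ∀ {n} (f : Vector Carrier n) → (∀ i → ¬ (f i < 0#)) → ¬ (sum f < 0#)
  sum-nonneg {ℕ.zero}  f f≮0 s<0 = <-irrefl refl s<0
  sum-nonneg {ℕ.suc n} f f≮0 s<0 with <-weaklyLinear s<0 (sum (f ∘ suc))
  ... | inj₁ p = f≮0 zero (x+y<y⇒x<0 p)
  ... | inj₂ p = sum-nonneg (f ∘ suc) (f≮0 ∘ suc) p

  sum-pos : ∀ {n} (f : Vector Carrier n) → (∀ i → ¬ (f i < 0#)) →
            ∀ i → 0# < f i → 0# < sum f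
  sum-pos f f≮0 zero    0<fi =
    <-respʳ (+-comm _ _) (pos+nonneg 0<fi (sum-nonneg (f ∘ suc) (f≮0 ∘ suc)))
  sum-pos f f≮0 (suc i) 0<fi =
    pos+nonneg (sum-pos (f ∘ suc) (f≮0 ∘ suc) i 0<fi) (f≮0 zero)

module WeightedGraphs {c ℓ₁ ℓ₂ ℓ₃} (ℝ : Reals c ℓ₁ ℓ₂ ℓ₃) where
  open Reals ℝ hiding (zero)
  open RealProperties ℝ
  open CommutativeRing ring using (semiring; *-commutativeSemigroup)
  open CommutativeMonoidSum (CommutativeRing.+-commutativeMonoid ring)
    using (sum-cong-≋; ∑-comm)
  open SemiringSum semiring using (*-distribˡ-sum)
  open CommutativeSemigroupProperties *-commutativeSemigroup using (interchange)
  open VectorEquality setoid public using (_≋_)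

  record WeightedGraph (n : ℕ) e : Set (c ⊔ ℓ₁ ⊔ ℓ₃ ⊔ lsuc e) where
    infix 4 _∼_
    field
      _∼_         : Rel (Fin n) e
      ∼-sym       : Symmetric _∼_
      weight      : Fin n → Fin n → Carrier
      weight-sym  : ∀ i j → weight i j ≈ weight j i
      weight-pos  : ∀ {i j} → i ∼ j → 0# < weight i j
      weight-zero : ∀ {i j} → ¬ (i ∼ j) → weight i j ≈ 0#

    Connected : Set e
    Connected = ∀ i j → Star _∼_ i j

  Operator : ℕ → Set c
  Operator n = Vector Carrier n → Vector Carrier n

  I : ∀ {n} → Operator n
  I = id

  infixl 6 _⊖_
  _⊖_ : ∀ {n} → Operator n → Operator n → Operator n
  (A ⊖ B) v i = A v i - B v i

  infixr 8 _^_
  _^_ : ∀ {n} → Operator n → ℕ → Operator n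
  _^_ {n} = Endo._^_ (Vector Carrier n)

  Weights : ℕ → Set c
  Weights n = Fin n → Fin n → Carrier

  degree : ∀ {n} → Weights n → Fin n → Carrier
  degree w i = sum (λ j → w i j)

  NonzeroDegrees : ∀ {n} → Weights n → Set ℓ₂
  NonzeroDegrees w = ∀ i → degree w i # 0#

  -- The sum over all tuples (k₁ , … , kₘ) of vertices.
  sumTuples : ∀ {n} m → (Vec (Fin n) m → Carrier) → Carrier
  sumTuples ℕ.zero    f = f []
  sumTuples (ℕ.suc m) f = sum (λ k → sumTuples m (λ ks → f (k ∷ ks)))

  -- w i k₁ * w k₁ k₂ * … * w kₘ j
  walkWeight : ∀ {n m} → Weights n → Fin n → Vec (Fin n) m → Fin n → Carrier
  walkWeight w i []       j = w i j
  walkWeight w i (k ∷ ks) j = w i k * walkWeight w k ks j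

  sumTuples-cong : ∀ {n} m {f g : Vec (Fin n) m → Carrier} →
                   (∀ ks → f ks ≈ g ks) → sumTuples m f ≈ sumTuples m g
  sumTuples-cong ℕ.zero    f≈g = f≈g []
  sumTuples-cong {n} (ℕ.suc m) f≈g =
    sum-cong-≋ {n} (λ k → sumTuples-cong m (λ ks → f≈g (k ∷ ks)))

  *-distribˡ-sumTuples : ∀ {n} m x (f : Vec (Fin n) m → Carrier) →
                         x * sumTuples m f ≈ sumTuples m (λ ks → x * f ks)
  *-distribˡ-sumTuples ℕ.zero    x f = refl
  *-distribˡ-sumTuples {n} (ℕ.suc m) x f =
    trans (*-distribˡ-sum x (λ k → sumTuples m (λ ks → f (k ∷ ks))))
          (sum-cong-≋ {n} (λ k → *-distribˡ-sumTuples m x (λ ks → f (k ∷ ks))))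

  module _ {n} (w : Weights n) (d#0 : NonzeroDegrees w) where

    recipDegree : Fin n → Carrier
    recipDegree i = recip (degree w i) (d#0 i)

    laplacian : Operator n
    laplacian v i = recipDegree i * sum (λ j → w i j * (v i - v j))

    transition : Operator n
    transition v i = recipDegree i * sum (λ j → w i j * v j)

    recipDegrees : ∀ {m} → Vec (Fin n) m → Carrier
    recipDegrees ks = Vec.foldr′ _*_ 1# (Vec.map recipDegree ks)

    walkSum : ℕ → Weights n
    walkSum m i j = sumTuples m (λ ks → recipDegrees ks * walkWeight w i ks j)

    neighborhoodWeight : (l : ℕ) .{{_ : NonZero l}} → Weights n
    neighborhoodWeight 1                   = w
    neighborhoodWeight (ℕ.suc m@(ℕ.suc _)) = walkSum m

    walkSum-suc : ∀ m i j →
      walkSum (ℕ.suc m) i j ≈ sum (λ k → (recipDegree k * w i k) * walkSum m k j)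
    walkSum-suc m i j = sum-cong-≋ {n} λ k → trans
      (sumTuples-cong m λ ks →
        interchange (recipDegree k) (recipDegrees ks) (w i k) (walkWeight w k ks j))
      (sym (*-distribˡ-sumTuples m (recipDegree k * w i k)
             (λ ks → recipDegrees ks * walkWeight w k ks j)))

    degree-walkSum : ∀ m i → degree (walkSum m) i ≈ degree w i
    degree-walkSum ℕ.zero    i = sum-cong-≋ {n} (λ j → *-identityˡ (w i j))
    degree-walkSum (ℕ.suc m) i = begin
      sum (λ j → walkSum (ℕ.suc m) i j)
        ≈⟨ sum-cong-≋ {n} (walkSum-suc m i) ⟩
      sum (λ j → sum (λ k → (recipDegree k * w i k) * walkSum m k j))
        ≈⟨ ∑-comm (λ j k → (recipDegree k * w i k) * walkSum m k j) ⟩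
      sum (λ k → sum (λ j → (recipDegree k * w i k) * walkSum m k j))
        ≈⟨ sum-cong-≋ {n} (λ k → sym (*-distribˡ-sum _ (walkSum m k))) ⟩
      sum (λ k → (recipDegree k * w i k) * degree (walkSum m) k)
        ≈⟨ sum-cong-≋ {n} (λ k → *-congˡ (degree-walkSum m k)) ⟩
      sum (λ k → (recipDegree k * w i k) * degree w k)
        ≈⟨ sum-cong-≋ {n} cancel ⟩
      sum (λ k → w i k) ∎
      where
      open ≈-Reasoning setoid
      cancel : ∀ k → (recipDegree k * w i k) * degree w k ≈ w i k
      cancel k = begin
        (recipDegree k * w i k) * degree w k  ≈⟨ *-congʳ (*-comm _ _) ⟩
        (w i k * recipDegree k) * degree w k  ≈⟨ *-assoc _ _ _ ⟩
        w i k * (recipDegree k * degree w k)  ≈⟨ *-congˡ (recip-inverseˡ _ (d#0 k)) ⟩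
        w i k * 1#                            ≈⟨ *-identityʳ _ ⟩
        w i k ∎

    neighborhoodDegrees#0 : (l : ℕ) .{{_ : NonZero l}} →
                            NonzeroDegrees (neighborhoodWeight l)
    neighborhoodDegrees#0 1                   i = d#0 i
    neighborhoodDegrees#0 (ℕ.suc m@(ℕ.suc _)) i =
      HeytingProperties.#-congʳ heytingCommutativeRing
        (sym (degree-walkSum m i)) (d#0 i)

  module _ {n e} (Γ : WeightedGraph n e) where
    open WeightedGraph Γ

    weight-nonneg : ∀ i j → ¬ (weight i j < 0#)
    weight-nonneg i j w<0 = <-irrefl (weight-zero i≁j) w<0
      where
      i≁j : ¬ (i ∼ j)
      i≁j i∼j = <-irrefl refl (<-trans (weight-pos i∼j) w<0)

    neighbor : 2 ℕ.≤ n → Connected → ∀ i → ∃[ j ] i ∼ j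
    neighbor 2≤n connected i with other 2≤n i
      where
      other : ∀ {n} → 2 ℕ.≤ n → (i : Fin n) → ∃[ j ] i ≢ j
      other (s≤s (s≤s _)) zero    = suc zero , λ ()
      other (s≤s (s≤s _)) (suc i) = zero , λ ()
    ... | j , i≢j with connected i j
    ...   | ε       = contradiction ≡.refl i≢j
    ...   | i∼k ◅ _ = _ , i∼k

    degrees#0 : 2 ℕ.≤ n → Connected → NonzeroDegrees weight
    degrees#0 2≤n connected i =
      let j , i∼j = neighbor 2≤n connected i
      in #-sym (<⇒# (sum-pos (weight i) (weight-nonneg i) j (weight-pos i∼j)))

  module GraphOperators {n e} (Γ : WeightedGraph n e)
    (2≤n : 2 ℕ.≤ n) (connected : WeightedGraph.Connected Γ) where
    open WeightedGraph Γ

    private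
      d#0 : NonzeroDegrees weight
      d#0 = degrees#0 Γ 2≤n connected

    Δ : Operator n
    Δ = laplacian weight d#0

    P : Operator n
    P = transition weight d#0

    Δ[_] : (l : ℕ) .{{_ : NonZero l}} → Operator n
    Δ[ l ] = laplacian (neighborhoodWeight weight d#0 l)
                       (neighborhoodDegrees#0 weight d#0 l)

{-# OPTIONS --safe #-}
-- Since r_i Σ_j w_ij = 1 with r_i = 1/d_i, every normalized Laplacian is the
-- identity minus the transition operator of the same weights.  Iterating the
-- transition operator P of w gives
--   (P^l u)(i) = r_i Σ_j w_ij[l] u(j),
-- and as d_i[l] = d_i, the right-hand side is the transition operator of w[l].
module Submission where

open import Defs
open import Algebra.Bundles using (CommutativeRing)
import Algebra.Properties.CommutativeMonoid.Sum as CommutativeMonoidSum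
import Algebra.Properties.CommutativeSemigroup as CommutativeSemigroupProperties
import Algebra.Properties.Group as GroupProperties
import Algebra.Properties.Semiring.Sum as SemiringSum
open import Data.Nat.Base using (ℕ; zero; suc; NonZero; _≤_)
open import Data.Product.Base using (_×_; _,_)
open import Data.Vec.Functional using (Vector)
import Relation.Binary.Reasoning.Setoid as ≈-Reasoning

module NeighborhoodOperators {c ℓ₁ ℓ₂ ℓ₃} (ℝ : Reals c ℓ₁ ℓ₂ ℓ₃) where
  open Reals ℝ hiding (zero)
  open RealProperties ℝ
  open WeightedGraphs ℝ
  open CommutativeRing ring using (semiring; +-group; *-commutativeSemigroup)
  open CommutativeMonoidSum (CommutativeRing.+-commutativeMonoid ring)
    using (sum-cong-≋; ∑-comm; ∑-distrib-+)
  open SemiringSum semiring using (*-distribˡ-sum; *-distribʳ-sum)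
  open CommutativeSemigroupProperties *-commutativeSemigroup using (x∙yz≈y∙xz; x∙yz≈yx∙z)
  open GroupProperties +-group using (x≈z//y; //-rightDividesˡ)
  open ≈-Reasoning setoid

  -- `recip` is computed from an apartness proof, so independence of that proof has to be derived.
  -- Inverses are unique: `r ≈ r * (s * y) ≈ s * (r * x) ≈ s`.
  recip-cong : ∀ {x y} (x#0 : x # 0#) (y#0 : y # 0#) → x ≈ y → recip x x#0 ≈ recip y y#0
  recip-cong {x} {y} x#0 y#0 x≈y = begin
    r            ≈⟨ *-identityʳ r ⟨
    r * 1#       ≈⟨ *-congˡ (recip-inverseˡ y y#0) ⟨
    r * (s * y)  ≈⟨ x∙yz≈y∙xz r s y ⟩
    s * (r * y)  ≈⟨ *-congˡ (*-congˡ x≈y) ⟨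
    s * (r * x)  ≈⟨ *-congˡ (recip-inverseˡ x x#0) ⟩
    s * 1#       ≈⟨ *-identityʳ s ⟩
    s            ∎
    where
    r = recip x x#0
    s = recip y y#0

  -- An `Operator` is a bare function that need not respect `≋`, so the hypothesis lets operator and
  -- argument change at once, which is what the induction step needs.
  ^-cong : ∀ {n} {A B : Operator n} → (∀ {u v} → u ≋ v → A u ≋ B v) →
           ∀ l u → (A ^ l) u ≋ (B ^ l) u
  ^-cong A≋B zero    u i = refl
  ^-cong A≋B (suc l) u   = A≋B (^-cong A≋B l u)

  module _ {n} (w : Weights n) (d#0 : NonzeroDegrees w) where

    private
      L P : Operator n
      L = laplacian w d#0
      P = transition w d#0

      r : Vector Carrier n
      r = recipDegree w d#0

    transition-cong : ∀ {u v} → u ≋ v → P u ≋ P v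
    transition-cong u≋v i = *-congˡ (sum-cong-≋ {n} (λ j → *-congˡ (u≋v j)))

    -- The terms `w i j * u j` cancel, and `r i * degree w i ≈ 1#` disposes of the rest. In this
    -- additive form, both `L = I ⊖ P` and `I ⊖ L = P` follow by moving one summand across.
    laplacian+transition : ∀ u i → L u i + P u i ≈ u i
    laplacian+transition u i = begin
      r i * sum (λ j → w i j * (u i - u j)) + r i * sum (λ j → w i j * u j)
        ≈⟨ distribˡ _ _ _ ⟨
      r i * (sum (λ j → w i j * (u i - u j)) + sum (λ j → w i j * u j))
        ≈⟨ *-congˡ (∑-distrib-+ _ (λ j → w i j * u j)) ⟨
      r i * sum (λ j → w i j * (u i - u j) + w i j * u j)
        ≈⟨ *-congˡ (sum-cong-≋ {n} (λ j → distribˡ _ _ _)) ⟨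
      r i * sum (λ j → w i j * (u i - u j + u j))
        ≈⟨ *-congˡ (sum-cong-≋ {n} (λ j → *-congˡ (//-rightDividesˡ (u j) (u i)))) ⟩
      r i * sum (λ j → w i j * u i)
        ≈⟨ *-congˡ (*-distribʳ-sum (u i) (w i)) ⟨
      r i * (degree w i * u i)
        ≈⟨ *-assoc _ _ _ ⟨
      (r i * degree w i) * u i
        ≈⟨ *-congʳ (recip-inverseˡ _ (d#0 i)) ⟩
      1# * u i
        ≈⟨ *-identityˡ _ ⟩
      u i ∎

    laplacian≋I⊖transition : ∀ u → L u ≋ (I ⊖ P) u
    laplacian≋I⊖transition u i = x≈z//y _ _ _ (laplacian+transition u i)

    I⊖laplacian≋transition : ∀ u → (I ⊖ L) u ≋ P u
    I⊖laplacian≋transition u i =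
      sym (x≈z//y _ _ _ (trans (+-comm _ _) (laplacian+transition u i)))

    [I⊖laplacian]^≋transition^ : ∀ l u → ((I ⊖ L) ^ l) u ≋ (P ^ l) u
    [I⊖laplacian]^≋transition^ = ^-cong λ {u} u≋v i →
      trans (I⊖laplacian≋transition u i) (transition-cong u≋v i)

    -- A walk with `m` intermediate vertices has `m + 1` steps, hence the exponent `suc m`. In the
    -- induction the outermost `P` supplies the first step from `i` to `k`. The inner factor `r k`
    -- joins `w i k` to match the recursion `walkSum-suc`, while `r i` stays in front.
    transition^≈walkSum : ∀ m u i →
      (P ^ suc m) u i ≈ r i * sum (λ j → walkSum w d#0 m i j * u j)
    transition^≈walkSum zero    u i =
      -- `walkSum` at zero still carries the empty product `1#` of reciprocals.
      *-congˡ (sum-cong-≋ {n} (λ j → *-congʳ (sym (*-identityˡ (w i j)))))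
    transition^≈walkSum (suc m) u i = *-congˡ (begin
      sum (λ k → w i k * (P ^ suc m) u k)
        ≈⟨ sum-cong-≋ {n} (λ k → *-congˡ (transition^≈walkSum m u k)) ⟩
      sum (λ k → w i k * (r k * sum (λ j → W k j * u j)))
        ≈⟨ sum-cong-≋ {n} (λ k → x∙yz≈yx∙z _ _ _) ⟩
      sum (λ k → (r k * w i k) * sum (λ j → W k j * u j))
        ≈⟨ sum-cong-≋ {n} (λ k → *-distribˡ-sum _ (λ j → W k j * u j)) ⟩
      sum (λ k → sum (λ j → (r k * w i k) * (W k j * u j)))
        ≈⟨ ∑-comm (λ k j → (r k * w i k) * (W k j * u j)) ⟩
      sum (λ j → sum (λ k → (r k * w i k) * (W k j * u j)))
        ≈⟨ sum-cong-≋ {n} (λ j → sum-cong-≋ {n} (λ k → *-assoc _ _ _)) ⟨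
      sum (λ j → sum (λ k → ((r k * w i k) * W k j) * u j))
        ≈⟨ sum-cong-≋ {n} (λ j → *-distribʳ-sum (u j) (λ k → (r k * w i k) * W k j)) ⟨
      sum (λ j → sum (λ k → (r k * w i k) * W k j) * u j)
        ≈⟨ sum-cong-≋ {n} (λ j → *-congʳ (walkSum-suc w d#0 m i j)) ⟨
      sum (λ j → walkSum w d#0 (suc m) i j * u j) ∎)
      where
      W : Weights n
      W = walkSum w d#0 m

    transition^≋neighborhoodTransition : ∀ l .{{_ : NonZero l}} u →
      (P ^ l) u ≋ transition (neighborhoodWeight w d#0 l) (neighborhoodDegrees#0 w d#0 l) u
    transition^≋neighborhoodTransition 1                 u i = refl
    transition^≋neighborhoodTransition (suc m@(suc _)) u i =
      trans (transition^≈walkSum m u i)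
            -- The walk formula divides by the degree of `w`, the target by the degree of
            -- `walkSum m`; the two degrees agree.
            (*-congʳ (recip-cong (d#0 i) _ (sym (degree-walkSum w d#0 m i))))

theorem5p2 : ∀ {c ℓ₁ ℓ₂ ℓ₃ e} (ℝ : Reals c ℓ₁ ℓ₂ ℓ₃) →
    let open Reals ℝ using (Carrier)
        open WeightedGraphs ℝ
    in ∀ {n : ℕ} (Γ : WeightedGraph n e) (2≤n : 2 ≤ n)
         (connected : WeightedGraph.Connected Γ) →
    let open GraphOperators Γ 2≤n connected
    in ∀ (l : ℕ) .{{_ : NonZero l}} (u : Vector Carrier n) →
       (I ⊖ (I ⊖ Δ) ^ l) u ≋ (I ⊖ P ^ l) u
       × (I ⊖ P ^ l) u ≋ Δ[ l ] u
theorem5p2 ℝ Γ 2≤n connected l u =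
  (λ i → //-cong₂ refl ([I⊖laplacian]^≋transition^ weight d#0 l u i)) ,
  (λ i → trans (//-cong₂ refl (transition^≋neighborhoodTransition weight d#0 l u i))
               -- Here the Laplacian identity is applied to the neighborhood weights instead of
               -- `weight`.
               (sym (laplacian≋I⊖transition _ (neighborhoodDegrees#0 weight d#0 l) u i)))
  where
  open Reals ℝ using (ring; refl; sym; trans)
  open WeightedGraphs ℝ
  open WeightedGraph Γ using (weight)
  open NeighborhoodOperators ℝ
  open GroupProperties (CommutativeRing.+-group ring) using (//-cong₂)
  d#0 : NonzeroDegrees weight
  d#0 = degrees#0 Γ 2≤n connected
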